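{- Let $\varepsilon,\delta\geq 0$ and let $\mathcal{M},\mathcal{N}$ be CTMCs with $\mathcal{M}\sim_{\varepsilon,\delta}\mathcal{N}$. Then there are CTMCs $\mathcal{M}'$ and $\mathcal{N}'$ with the same graph structure such that $\mathcal{M}\sim_{\varepsilon,0}\mathcal{M}'$, $\mathcal{M}'\sim_{0,\delta}\mathcal{N}'$, and $\mathcal{N}'\sim\mathcal{N}$.
   Context: A CTMC is a tuple $(S,P,E,s_{init},L)$ with $S$ a finite nonempty set of states, $P\colon S\to\mathrm{Distr}(S)$ a transition probability function (self-loops allowed; $P(s,A)=\sum_{a\in A}P(s,a)$), $E\colon S\to\mathbb{R}_{>0}$ an exit rate function, $s_{init}\in S$ an initial state and $L\colon S\to 2^{AP}$ a labeling. Two CTMCs have the same graph structure if they have the same state set, initial state, labeling, and the same pairs of states connected by transitions of positive probability. For a relation $R\subseteq S\times S$ and $A\subseteq S$, $R(A)=\{t\mid\exists s\in A:(s,t)\in R\}$. For $\varepsilon,\delta\geq0$, a reflexive symmetric relation $R$ on the states of a CTMC is an $(\varepsilon,\delta)$-bisimulation if for all $(s,s')\in R$: $L(s)=L(s')$, $|\ln E(s)-\ln E(s')|\leq\delta$, and $P(s,A)\leq P(s',R(A))+\varepsilon$ for all sets of states $A$; $s\sim_{\varepsilon,\delta}s'$ if some $(\varepsilon,\delta)$-bisimulation contains $(s,s')$. A strong bisimulation is an equivalence $R$ with $L(s)=L(s')$, $E(s)=E(s')$ and $P(s,C)=P(s',C)$ for every equivalence class $C$ whenever $(s,s')\in R$;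 $s\sim s'$ if some strong bisimulation contains $(s,s')$. For CTMCs $\mathcal{M}_1,\mathcal{M}_2$, the direct sum $\mathcal{M}_1\oplus\mathcal{M}_2$ is their disjoint union; $\mathcal{M}_1\sim_{\varepsilon,\delta}\mathcal{M}_2$ (resp. $\mathcal{M}_1\sim\mathcal{M}_2$) means that the initial states of $\mathcal{M}_1$ and $\mathcal{M}_2$ satisfy $\sim_{\varepsilon,\delta}$ (resp. $\sim$) in $\mathcal{M}_1\oplus\mathcal{M}_2$. -}

module Defs where

open import Algebra.Bundles using (CommutativeRing)
import Algebra.Properties.CommutativeMonoid.Sum as Sum
open import Data.Bool.Base using (if_then_else_)
open import Data.Fin.Base using (Fin; zero; suc; splitAt; _↑ˡ_; _↑ʳ_)
open import Data.Fin.Properties using (any?; splitAt-↑ˡ; splitAt-↑ʳ; +↔⊎)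
open import Data.Nat.Base as ℕ using (ℕ; zero; suc)
open import Data.Product.Base using (∃; _×_; _,_)
open import Data.Sum.Base as Sum⊎ using (_⊎_; inj₁; inj₂; [_,_])
open import Data.Sum.Function.Propositional using (_⊎-↔_)
open import Data.Vec.Functional using (Vector)
open import Function.Base using (_∘_; const)
open import Function.Bundles using (_↔_; _⇔_; module Inverse)
open import Function.Construct.Composition using (_↔-∘_)
open import Function.Construct.Symmetry using (↔-sym)
open import Level as Level using (0ℓ)
open import Relation.Binary.Core using (Rel)
import Relation.Binary.Construct.NonStrictToStrict as ToStrict
open import Relation.Binary.Definitions using (Reflexive; Symmetric)
import Relation.Binary.Definitions as Binary
open import Relation.Binary.PropositionalEquality.Core as ≡ using (_≡_)
open import Relation.Binary.Structures using (IsDecTotalOrder; IsEquivalence)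
open import Relation.Nullary.Decidable as Dec using (Dec; _×-dec_; does)
open import Relation.Nullary.Negation using (¬_)
open import Relation.Unary using (Pred; Decidable; _≐_)

-- The classical real numbers, characterised (uniquely up to isomorphism) as a
-- Dedekind-complete ordered field.  Equality is the setoid equality _≈_ and, as
-- usual classically, the order is decidable.
record Reals : Set₁ where
  infix 4 _≤_
  field
    commutativeRing : CommutativeRing 0ℓ 0ℓ

  open CommutativeRing commutativeRing public
    renaming (Carrier to ℝ)

  field
    _≤_             : Rel ℝ 0ℓ
    isDecTotalOrder : IsDecTotalOrder _≈_ _≤_

  open ToStrict _≈_ _≤_ public using (_<_)

  UpperBound : Pred ℝ 0ℓ → Pred ℝ 0ℓ
  UpperBound A b = ∀ x → A x → x ≤ b

  field
    0≉1         : ¬ 0# ≈ 1#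
    *-inverse   : ∀ x → ¬ x ≈ 0# → ∃ λ y → x * y ≈ 1#
    +-monoʳ-≤   : ∀ z {x y} → x ≤ y → z + x ≤ z + y
    *-nonneg    : ∀ {x y} → 0# ≤ x → 0# ≤ y → 0# ≤ x * y
    supremum    : (A : Pred ℝ 0ℓ) → ∃ A → ∃ (UpperBound A) →
                  ∃ λ s → UpperBound A s × (∀ b → UpperBound A b → s ≤ b)

    -- On the positive reals, the last two laws characterise the natural
    -- logarithm; its values elsewhere are unspecified.
    ln      : ℝ → ℝ
    ln-cong : ∀ {x y} → x ≈ y → ln x ≈ ln y
    ln-*    : ∀ {x y} → 0# < x → 0# < y → ln (x * y) ≈ ln x + ln y
    ln-≤    : ∀ {x} → 0# < x → ln x ≤ x - 1#

  open IsDecTotalOrder isDecTotalOrder public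
    using (_≤?_)
    renaming ( isPartialOrder to ≤-isPartialOrder; refl to ≤-refl
             ; reflexive to ≤-reflexive; trans to ≤-trans
             ; antisym to ≤-antisym; total to ≤-total; _≟_ to _≈?_)

  ∣_∣ : ℝ → ℝ
  ∣ x ∣ = if does (0# ≤? x) then x else - x

record FiniteSet : Set₁ where
  field
    Elem : Set
    size : ℕ
    enum : Elem ↔ Fin size

  index : Elem → Fin size
  index = Inverse.to enum

  element : Fin size → Elem
  element = Inverse.from enum

  element-index : ∀ x → element (index x) ≡ x
  element-index = Inverse.strictlyInverseʳ enum

  ∃? : {A : Pred Elem 0ℓ} → Decidable A → Dec (∃ A)
  ∃? {A} A? = Dec.map′
    (λ (i , a) → element i , a)
    (λ (x , a) → index x , ≡.subst A (≡.sym (element-index x)) a)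
    (any? (A? ∘ element))

open FiniteSet public using (Elem)

_⊎ᶠ_ : FiniteSet → FiniteSet → FiniteSet
S ⊎ᶠ T = record
  { Elem = Elem S ⊎ Elem T
  ; size = S.size ℕ.+ T.size
  ; enum = ↔-sym +↔⊎ ↔-∘ (S.enum ⊎-↔ T.enum)
  }
  where
  module S = FiniteSet S
  module T = FiniteSet T

-- R ⟦ A ⟧ is the relational image R(A).
_⟦_⟧ : {S : Set} → Rel S 0ℓ → Pred S 0ℓ → Pred S 0ℓ
(R ⟦ A ⟧) t = ∃ λ s → A s × R s t

image? : (S : FiniteSet) {R : Rel (Elem S) 0ℓ} {A : Pred (Elem S) 0ℓ} →
         Binary.Decidable R → Decidable A → Decidable (R ⟦ A ⟧)
image? S R? A? t = FiniteSet.∃? S (λ s → A? s ×-dec R? s t)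

module Theory (reals : Reals) where
  open Reals reals
  open Sum +-commutativeMonoid using (sum; sum-cong-≗; sum-replicate-zero)

  ∑ : (S : FiniteSet) → (Elem S → ℝ) → ℝ
  ∑ S f = sum (f ∘ FiniteSet.element S)

  private
    sum-++ : ∀ m {n} (f : Vector ℝ (m ℕ.+ n)) →
             sum f ≈ sum (f ∘ (_↑ˡ n)) + sum (f ∘ (m ↑ʳ_))
    sum-++ zero    f = sym (+-identityˡ _)
    sum-++ (suc m) f =
      trans (+-congˡ (sum-++ m (f ∘ suc))) (sym (+-assoc _ _ _))

  ∑-⊎ : (S T : FiniteSet) (f : Elem (S ⊎ᶠ T) → ℝ) →
        ∑ (S ⊎ᶠ T) f ≈ ∑ S (f ∘ inj₁) + ∑ T (f ∘ inj₂)
  ∑-⊎ S T f = trans (sum-++ S.size _) (+-cong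
    (reflexive (sum-cong-≗ λ i → ≡.cong g (splitAt-↑ˡ S.size i T.size)))
    (reflexive (sum-cong-≗ λ j → ≡.cong g (splitAt-↑ʳ S.size T.size j))))
    where
    module S = FiniteSet S
    module T = FiniteSet T
    g : Fin S.size ⊎ Fin T.size → ℝ
    g = f ∘ Sum⊎.map S.element T.element

  record Distr (S : FiniteSet) : Set where
    field
      prob   : Elem S → ℝ
      nonneg : ∀ s → 0# ≤ prob s
      total  : ∑ S prob ≈ 1#

  open Distr public

  -- The subset A is classical, hence given with a decision procedure.
  Pr : {S : FiniteSet} → Distr S → {A : Pred (Elem S) 0ℓ} → Decidable A → ℝ
  Pr {S} μ A? = ∑ S λ a → if does (A? a) then prob μ a else 0#

  module _ {S T : FiniteSet} where

    inj₁-distr : Distr S → Distr (S ⊎ᶠ T)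
    inj₁-distr μ = record
      { prob   = [ prob μ , const 0# ]
      ; nonneg = [ nonneg μ , const ≤-refl ]
      ; total  = trans (∑-⊎ S T [ prob μ , const 0# ])
          (trans (+-cong (total μ) (sum-replicate-zero (FiniteSet.size T)))
                 (+-identityʳ 1#))
      }

    inj₂-distr : Distr T → Distr (S ⊎ᶠ T)
    inj₂-distr μ = record
      { prob   = [ const 0# , prob μ ]
      ; nonneg = [ const ≤-refl , nonneg μ ]
      ; total  = trans (∑-⊎ S T [ const 0# , prob μ ])
          (trans (+-cong (sum-replicate-zero (FiniteSet.size S)) (total μ))
                 (+-identityˡ 1#))
      }

  record CTMC (AP : Set) (S : FiniteSet) : Set₁ where
    field
      P     : Elem S → Distr S
      E     : Elem S → ℝ
      E-pos : ∀ s → 0# < E s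
      init  : Elem S
      L     : Elem S → Pred AP 0ℓ

  record SameGraph {AP : Set} {S : FiniteSet} (M N : CTMC AP S) : Set where
    private
      module M = CTMC M
      module N = CTMC N
    field
      init-≡ : M.init ≡ N.init
      L-≐    : ∀ s → M.L s ≐ N.L s
      edge-⇔ : ∀ s t → 0# < prob (M.P s) t ⇔ 0# < prob (N.P s) t

  -- The choice of initial state is immaterial: neither notion of bisimilarity
  -- of states depends on it.
  _⊕_ : ∀ {AP S T} → CTMC AP S → CTMC AP T → CTMC AP (S ⊎ᶠ T)
  M ⊕ N = record
    { P     = [ inj₁-distr ∘ M.P , inj₂-distr ∘ N.P ]
    ; E     = [ M.E , N.E ]
    ; E-pos = [ M.E-pos , N.E-pos ]
    ; init  = inj₁ M.init
    ; L     = [ M.L , N.L ]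
    }
    where
    module M = CTMC M
    module N = CTMC N

  record IsApproxBisimulation {AP : Set} {S : FiniteSet} (ε δ : ℝ)
    (M : CTMC AP S) (R : Rel (Elem S) 0ℓ) : Set₁ where
    open CTMC M
    field
      R?          : Binary.Decidable R
      reflexivity : Reflexive R
      symmetry    : Symmetric R
      label       : ∀ {s s′} → R s s′ → L s ≐ L s′
      rate        : ∀ {s s′} → R s s′ → ∣ ln (E s) - ln (E s′) ∣ ≤ δ
      step        : ∀ {s s′} → R s s′ →
                    (A : Pred (Elem S) 0ℓ) (A? : Decidable A) →
                    Pr (P s) A? ≤ Pr (P s′) (image? S R? A?) + ε

  record IsStrongBisimulation {AP : Set} {S : FiniteSet}
    (M : CTMC AP S) (R : Rel (Elem S) 0ℓ) : Set where
    open CTMC M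
    field
      R?            : Binary.Decidable R
      isEquivalence : IsEquivalence R
      label         : ∀ {s s′} → R s s′ → L s ≐ L s′
      rate          : ∀ {s s′} → R s s′ → E s ≈ E s′
      -- The equivalence classes are the sets R c.
      step          : ∀ {s s′} → R s s′ →
                      ∀ c → Pr (P s) (R? c) ≈ Pr (P s′) (R? c)

  ApproxBisimilarStates : ∀ {AP S} (ε δ : ℝ) → CTMC AP S → Rel (Elem S) (Level.suc 0ℓ)
  ApproxBisimilarStates ε δ M s s′ =
    ∃ λ R → IsApproxBisimulation ε δ M R × R s s′

  StronglyBisimilarStates : ∀ {AP S} → CTMC AP S → Rel (Elem S) (Level.suc 0ℓ)
  StronglyBisimilarStates M s s′ = ∃ λ R → IsStrongBisimulation M R × R s s′

  infix 4 _∼[_,_]_ _∼_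

  _∼[_,_]_ : ∀ {AP S T} → CTMC AP S → ℝ → ℝ → CTMC AP T → Set₁
  M ∼[ ε , δ ] N =
    ApproxBisimilarStates ε δ (M ⊕ N) (inj₁ (CTMC.init M)) (inj₂ (CTMC.init N))

  _∼_ : ∀ {AP S T} → CTMC AP S → CTMC AP T → Set₁
  M ∼ N =
    StronglyBisimilarStates (M ⊕ N) (inj₁ (CTMC.init M)) (inj₂ (CTMC.init N))

{-# OPTIONS --safe #-}
module Submission where

-- A state of M′ and N′ is in essence a related pair (s , t), which couples P s with
-- P t, or a bare copy of a state t of N.  Since P s A ≤ P t (R A) + ε, max-flow
-- min-cut yields a plan supported on R whose columns are bounded by P t and whose
-- rows fall short of P s by at most ε in total; what the plan leaves of P t goes
-- to the bare copies.  Hence forgetting s is an exact projection onto N, while s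
-- and (s , t) are ε-close.  M′ and N′ share these transitions and differ only in
-- the rate of a related pair, E s against E t.

open import Defs
import Algebra.Properties.AbelianGroup as AbelianGroupProperties
import Algebra.Properties.CommutativeMonoid.Sum as Sum
open import Data.Bool.Base using (if_then_else_)
open import Data.Empty using (⊥)
open import Data.Fin.Base using (Fin; zero; suc; combine; _↑ˡ_; _↑ʳ_)
import Data.Fin.Properties as Fin
open import Data.Fin.Subset
  using (Subset; inside; outside; _∈_; _∉_; _∪_; _∩_; ∁; ⁅_⁆)
  renaming (⊥ to ∅)
open import Data.Fin.Subset.Properties
  using ( _∈?_; ∉⊥; x∈⁅x⁆; x∈⁅y⁆⇒x≡y; ∩⇔×; ∪⇔⊎; x∈p∪q⁻; x∈p∪q⁺; x∈p∩q⁻; x∈p∩q⁺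
        ; x∈∁p⇒x∉p; x∉p⇒x∈∁p )
open import Data.List.Base
  using (List; []; _∷_; map; _++_; filter; cartesianProduct; allFin)
import Data.List.Extrema as Extrema
open import Data.List.Membership.Propositional using ()
  renaming (_∈_ to _∈ᴸ_; _∉_ to _∉ᴸ_)
open import Data.List.Membership.Propositional.Properties
  using ( ∈-map⁺; ∈-++⁺ˡ; ∈-++⁺ʳ; ∈-filter⁺; ∈-filter⁻; ∈-cartesianProduct⁺
        ; ∈-allFin )
open import Data.List.Relation.Unary.All as All using (All; []; _∷_)
import Data.List.Relation.Unary.All.Properties as All
open import Data.List.Relation.Unary.Any using (here; there)
open import Data.Nat.Base as ℕ using (ℕ; zero; suc)
open import Data.Product using (Σ; _×_; _,_; proj₁; proj₂; uncurry)
open import Data.Product.Function.NonDependent.Propositional using (_×-↔_)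
open import Data.Sum.Base using (_⊎_; inj₁; inj₂; [_,_])
open import Data.Unit.Base using (⊤; tt)
open import Data.Vec.Base using ([]; _∷_)
open import Function.Base using (_∘_; flip; id; const)
open import Function.Bundles using (_⇔_; mk⇔; module Inverse)
open import Function.Construct.Composition using (_↔-∘_)
open import Function.Construct.Identity using (⇔-id)
open import Function.Construct.Symmetry using (↔-sym)
open import Function.Properties.Inverse using (↔⇒↣)
open import Level using (0ℓ)
open import Relation.Binary.Bundles using (DecTotalOrder)
open import Relation.Binary.Core using (Rel)
open import Relation.Binary.Definitions using (DecidableEquality)
import Relation.Binary.Definitions as Binary
open import Relation.Binary.PropositionalEquality as ≡ using (_≡_)
import Relation.Binary.Reasoning.PartialOrder as PartialOrderReasoning
open import Relation.Nullary.Decidable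
  using (Dec; yes; no; does; _×-dec_; _⊎-dec_; _→-dec_; ¬?; does-⇔)
open import Relation.Nullary.Negation using (¬_; contradiction)
open import Relation.Unary using (Pred; Decidable; _≐_)
open import Relation.Unary.Properties using (≐-refl; ≐-sym; ≐-trans)

open FiniteSet using (size; index; element; element-index)

-- `R` need not be transitive, so related states cannot be merged into classes; a state has to
-- remember both partners, and every related pair gets a coupling of its own. `N′ ∼ N` tolerates no
-- error, so all of `P t` must be distributed, including what finds no partner: that is the purpose
-- of the bare copies, which behave exactly as `N` does. Since `P s` and `P t` both have total one,
-- the part of `P t` sent to the copies weighs as much as the shortfall of `P s`. Hence one
-- one-sided inequality bounds the error by ε in both directions. The induction is on the list of
-- edges instead: as much as possible is shipped along one edge, which is then discarded, and the
-- cut condition is shown to survive. The bound on what can be shipped is a minimum over finitely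
-- many cuts, whence the explicit list of subsets.

subsets : ∀ n → List (Subset n)
subsets zero    = [] ∷ []
subsets (suc n) = map (inside ∷_) (subsets n) ++ map (outside ∷_) (subsets n)

∈-subsets : ∀ {n} (A : Subset n) → A ∈ᴸ subsets n
∈-subsets []            = here ≡.refl
∈-subsets (inside  ∷ A) = ∈-++⁺ˡ (∈-map⁺ (inside ∷_) (∈-subsets A))
∈-subsets (outside ∷ A) = ∈-++⁺ʳ _ (∈-map⁺ (outside ∷_) (∈-subsets A))

-- Ordered-field arithmetic and finite sums.

module OrderedField (reals : Reals) where
  open Reals reals hiding (zero) public
  open AbelianGroupProperties +-abelianGroup public
    using (//-rightDividesˡ; //-rightDividesʳ; ⁻¹-anti-homo-//; x≈y⇒x∙y⁻¹≈ε)
  open Sum +-commutativeMonoid public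
    using (sum; sum-cong-≋; sum-replicate-zero; ∑-distrib-+; ∑-comm)

  decTotalOrder : DecTotalOrder 0ℓ 0ℓ 0ℓ
  decTotalOrder = record { isDecTotalOrder = isDecTotalOrder }

  open DecTotalOrder decTotalOrder public using (poset; totalOrder)
  open PartialOrderReasoning poset public
  open Extrema totalOrder public
    using (argmin; argmin-all; f[argmin]≤f[xs])

  +-mono-≤ : ∀ {x y u v} → x ≤ y → u ≤ v → x + u ≤ y + v
  +-mono-≤ {x} {y} {u} {v} x≤y u≤v = begin
    x + u  ≤⟨ +-monoʳ-≤ x u≤v ⟩
    x + v  ≈⟨ +-comm x v ⟩
    v + x  ≤⟨ +-monoʳ-≤ v x≤y ⟩
    v + y  ≈⟨ +-comm v y ⟩
    y + v  ∎

  +-monoˡ-≤ : ∀ z {x y} → x ≤ y → x + z ≤ y + z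
  +-monoˡ-≤ z x≤y = +-mono-≤ x≤y ≤-refl

  +-cancelʳ-≤ : ∀ {x y} z → x + z ≤ y + z → x ≤ y
  +-cancelʳ-≤ {x} {y} z x+z≤y+z = begin
    x            ≈⟨ //-rightDividesʳ z x ⟨
    x + z - z    ≤⟨ +-monoˡ-≤ (- z) x+z≤y+z ⟩
    y + z - z    ≈⟨ //-rightDividesʳ z y ⟩
    y            ∎

  x≤x+y : ∀ {x y} → 0# ≤ y → x ≤ x + y
  x≤x+y {x} {y} 0≤y = begin
    x       ≈⟨ +-identityʳ x ⟨
    x + 0#  ≤⟨ +-monoʳ-≤ x 0≤y ⟩
    x + y   ∎

  x≤y⇒0≤y-x : ∀ {x y} → x ≤ y → 0# ≤ y - x
  x≤y⇒0≤y-x {x} {y} x≤y = begin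
    0#     ≈⟨ -‿inverseʳ x ⟨
    x - x  ≤⟨ +-monoˡ-≤ (- x) x≤y ⟩
    y - x  ∎

  0≤x⇒-x≤0 : ∀ {x} → 0# ≤ x → - x ≤ 0#
  0≤x⇒-x≤0 {x} 0≤x = begin
    - x      ≈⟨ +-identityˡ (- x) ⟨
    0# - x   ≤⟨ +-monoˡ-≤ (- x) 0≤x ⟩
    x - x    ≈⟨ -‿inverseʳ x ⟩
    0#       ∎

  ∣-∣-comm : ∀ x y → ∣ x - y ∣ ≈ ∣ y - x ∣
  ∣-∣-comm x y with 0# ≤? x - y | 0# ≤? y - x
  ... | yes 0≤x-y | yes 0≤y-x = trans (zero-of 0≤x-y 0≤y-x) (sym (zero-of 0≤y-x 0≤x-y))
    where
    zero-of : ∀ {u v} → 0# ≤ u - v → 0# ≤ v - u → u - v ≈ 0#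
    zero-of {u} {v} 0≤u-v 0≤v-u = ≤-antisym
      (≤-trans (≤-reflexive (sym (⁻¹-anti-homo-// v u))) (0≤x⇒-x≤0 0≤v-u)) 0≤u-v
  ... | yes _     | no  _     = sym (⁻¹-anti-homo-// y x)
  ... | no  _     | yes _     = ⁻¹-anti-homo-// x y
  ... | no  0≰x-y | no  0≰y-x with ≤-total x y
  ...   | inj₁ x≤y = contradiction (x≤y⇒0≤y-x x≤y) 0≰y-x
  ...   | inj₂ y≤x = contradiction (x≤y⇒0≤y-x y≤x) 0≰x-y

  ∣x-x∣≤y : ∀ x {y} → 0# ≤ y → ∣ x - x ∣ ≤ y
  ∣x-x∣≤y x {y} 0≤y with 0# ≤? x - x
  ... | yes _ = ≤-trans (≤-reflexive (-‿inverseʳ x)) 0≤y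
  ... | no 0≰x-x = contradiction (≤-reflexive (sym (-‿inverseʳ x))) 0≰x-x

  sum-mono : ∀ {n} {f g : Fin n → ℝ} → (∀ i → f i ≤ g i) → sum f ≤ sum g
  sum-mono {zero}  f≤g = ≤-refl
  sum-mono {suc n} f≤g = +-mono-≤ (f≤g zero) (sum-mono (f≤g ∘ suc))

  sum-nonneg : ∀ {n} {f : Fin n → ℝ} → (∀ i → 0# ≤ f i) → 0# ≤ sum f
  sum-nonneg {n} 0≤f = ≤-trans (≤-reflexive (sym (sum-replicate-zero n))) (sum-mono 0≤f)

  sum-zero : ∀ {n} {f : Fin n → ℝ} → (∀ i → f i ≈ 0#) → sum f ≈ 0#
  sum-zero {n} f≈0 = trans (sum-cong-≋ f≈0) (sum-replicate-zero n)

  sum-++ : ∀ m {n} (f : Fin (m ℕ.+ n) → ℝ) →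
           sum f ≈ sum (f ∘ (_↑ˡ n)) + sum (f ∘ (m ↑ʳ_))
  sum-++ zero    f = sym (+-identityˡ _)
  sum-++ (suc m) f = trans (+-congˡ (sum-++ m (f ∘ suc))) (sym (+-assoc _ _ _))

  sum-combine : ∀ m {n} (f : Fin (m ℕ.* n) → ℝ) →
                sum f ≈ sum (λ i → sum λ j → f (combine {m} i j))
  sum-combine zero        f = refl
  sum-combine (suc m) {n} f =
    trans (sum-++ n f) (+-congˡ (sum-combine m (f ∘ (n ↑ʳ_))))

  -- Restricted sums and masses of subsets.

  restrict : {A : Set} → Dec A → ℝ → ℝ
  restrict a? x = if does a? then x else 0#

  module _ {A : Set} where

    restrict-yes : (a? : Dec A) {x : ℝ} → A → restrict a? x ≈ x
    restrict-yes (yes _) a = refl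
    restrict-yes (no ¬a) a = contradiction a ¬a

    restrict-no : (a? : Dec A) {x : ℝ} → ¬ A → restrict a? x ≈ 0#
    restrict-no (yes a) ¬a = contradiction a ¬a
    restrict-no (no _)  ¬a = refl

    restrict-cong : (a? : Dec A) {x y : ℝ} → x ≈ y → restrict a? x ≈ restrict a? y
    restrict-cong (yes _) x≈y = x≈y
    restrict-cong (no _)  x≈y = refl

    restrict-zero : (a? : Dec A) → restrict a? 0# ≈ 0#
    restrict-zero (yes _) = refl
    restrict-zero (no _)  = refl

    restrict-nonneg : (a? : Dec A) {x : ℝ} → 0# ≤ x → 0# ≤ restrict a? x
    restrict-nonneg (yes _) 0≤x = 0≤x
    restrict-nonneg (no _)  0≤x = ≤-refl

    restrict-≤ : (a? : Dec A) {x : ℝ} → 0# ≤ x → restrict a? x ≤ x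
    restrict-≤ (yes _) 0≤x = ≤-refl
    restrict-≤ (no _)  0≤x = 0≤x

    restrict-least : (a? : Dec A) {x y : ℝ} → 0# ≤ y → (A → x ≤ y) → restrict a? x ≤ y
    restrict-least (yes a) 0≤y x≤y = x≤y a
    restrict-least (no _)  0≤y x≤y = 0≤y

    restrict-+ : (a? : Dec A) (x y : ℝ) → restrict a? (x + y) ≈ restrict a? x + restrict a? y
    restrict-+ (yes _) x y = refl
    restrict-+ (no _)  x y = sym (+-identityʳ 0#)

    restrict-sum : (a? : Dec A) {n : ℕ} (f : Fin n → ℝ) →
                   restrict a? (sum f) ≈ sum (restrict a? ∘ f)
    restrict-sum (yes _)     f = refl
    restrict-sum (no _)  {n} f = sym (sum-replicate-zero n)

  _↾_ : {X : Set} → (X → ℝ) → {A : Pred X 0ℓ} → Decidable A → X → ℝ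
  (f ↾ A?) x = restrict (A? x) (f x)

  restrict-⇔ : {A B : Set} → A ⇔ B → (a? : Dec A) (b? : Dec B) {x : ℝ} →
               restrict a? x ≈ restrict b? x
  restrict-⇔ A⇔B a? b? = reflexive (≡.cong (if_then _ else _) (does-⇔ A⇔B a? b?))

  restrict-mono : {A B : Set} (a? : Dec A) (b? : Dec B) {x : ℝ} → (A → B) → 0# ≤ x →
                  restrict a? x ≤ restrict b? x
  restrict-mono a? b? A→B 0≤x = restrict-least a? (restrict-nonneg b? 0≤x)
    (≤-reflexive ∘ sym ∘ restrict-yes b? ∘ A→B)

  restrict-⊎-× : {A B : Set} (a? : Dec A) (b? : Dec B) {x : ℝ} →
    restrict a? x + restrict b? x ≈ restrict (a? ⊎-dec b?) x + restrict (a? ×-dec b?) x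
  restrict-⊎-× (yes _) (yes _) = refl
  restrict-⊎-× (yes _) (no _)  = refl
  restrict-⊎-× (no _)  (yes _) = +-comm _ _
  restrict-⊎-× (no _)  (no _)  = refl

  point : ∀ {n} → Fin n → ℝ → Fin n → ℝ
  point i x j = restrict (i Fin.≟ j) x

  sum-point : ∀ {n} (i : Fin n) x → sum (point i x) ≈ x
  sum-point {suc n} zero    x = trans (+-congˡ (sum-replicate-zero n)) (+-identityʳ x)
  sum-point         (suc i) x = trans (+-identityˡ _) (sum-point i x)

  mass : ∀ {n} → (Fin n → ℝ) → Subset n → ℝ
  mass f A = sum λ i → restrict (i ∈? A) (f i)

  mass-+ : ∀ {n} (f g : Fin n → ℝ) A → mass (λ i → f i + g i) A ≈ mass f A + mass g A
  mass-+ {n} f g A = trans (sum-cong-≋ λ i → restrict-+ (i ∈? A) (f i) (g i)) (∑-distrib-+ {n} _ _)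

  mass-cong : ∀ {n} {f g : Fin n → ℝ} A → (∀ i → f i ≈ g i) → mass f A ≈ mass g A
  mass-cong A f≈g = sum-cong-≋ λ i → restrict-cong (i ∈? A) (f≈g i)

  -- Modularity, by inclusion-exclusion at each index. This is what allows two cuts to be uncrossed.
  mass-∪-∩ : ∀ {n} (f : Fin n → ℝ) A B → mass f A + mass f B ≈ mass f (A ∪ B) + mass f (A ∩ B)
  mass-∪-∩ {n} f A B = begin-equality
    mass f A + mass f B
      ≈⟨ ∑-distrib-+ {n} _ _ ⟨
    sum (λ i → restrict (i ∈? A) (f i) + restrict (i ∈? B) (f i))
      ≈⟨ sum-cong-≋ pointwise ⟩
    sum (λ i → restrict (i ∈? A ∪ B) (f i) + restrict (i ∈? A ∩ B) (f i))
      ≈⟨ ∑-distrib-+ {n} _ _ ⟩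
    mass f (A ∪ B) + mass f (A ∩ B) ∎
    where
    pointwise : ∀ i → restrict (i ∈? A) (f i) + restrict (i ∈? B) (f i)
                    ≈ restrict (i ∈? A ∪ B) (f i) + restrict (i ∈? A ∩ B) (f i)
    pointwise i = trans (restrict-⊎-× (i ∈? A) (i ∈? B)) (sym (+-cong
      (restrict-⇔ ∪⇔⊎ (i ∈? A ∪ B) (i ∈? A ⊎-dec i ∈? B))
      (restrict-⇔ ∩⇔× (i ∈? A ∩ B) (i ∈? A ×-dec i ∈? B))))

  mass-⁅⁆ : ∀ {n} (f : Fin n → ℝ) i → mass f ⁅ i ⁆ ≈ f i
  mass-⁅⁆ f i = trans (sum-cong-≋ pointwise) (sum-point i (f i))
    where
    pointwise : ∀ j → restrict (j ∈? ⁅ i ⁆) (f j) ≈ point i (f i) j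
    pointwise j with i Fin.≟ j
    ... | yes ≡.refl = restrict-yes (i ∈? ⁅ i ⁆) (x∈⁅x⁆ i)
    ... | no i≢j     = restrict-no (j ∈? ⁅ i ⁆) (i≢j ∘ ≡.sym ∘ x∈⁅y⁆⇒x≡y i)

  mass-∅ : ∀ {n} (f : Fin n → ℝ) → mass f ∅ ≈ 0#
  mass-∅ {n} f = sum-zero {n} λ i → restrict-no (i ∈? ∅) ∉⊥

  mass-point : ∀ {n} (i : Fin n) x A → mass (point i x) A ≈ restrict (i ∈? A) x
  mass-point i x A = trans (sum-cong-≋ pointwise) (sum-point i _)
    where
    pointwise : ∀ j → restrict (j ∈? A) (point i x j) ≈ point i (restrict (i ∈? A) x) j
    pointwise j with i Fin.≟ j
    ... | yes ≡.refl = refl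
    ... | no _       = restrict-zero (j ∈? A)

  lower : ∀ {n} → Fin n → ℝ → (Fin n → ℝ) → Fin n → ℝ
  lower i x f j = f j - point i x j

  lower-+ : ∀ {n} (i : Fin n) x f j → lower i x f j + point i x j ≈ f j
  lower-+ i x f j = //-rightDividesˡ (point i x j) (f j)

  mass-lower : ∀ {n} (i : Fin n) x f A → mass (lower i x f) A + restrict (i ∈? A) x ≈ mass f A
  mass-lower i x f A = begin-equality
    mass (lower i x f) A + restrict (i ∈? A) x      ≈⟨ +-congˡ (mass-point i x A) ⟨
    mass (lower i x f) A + mass (point i x) A       ≈⟨ mass-+ _ _ A ⟨
    mass (λ j → lower i x f j + point i x j) A      ≈⟨ mass-cong A (lower-+ i x f) ⟩
    mass f A                                        ∎

  mass-lower-∈ : ∀ {n} {i : Fin n} {x f A} → i ∈ A → mass (lower i x f) A + x ≈ mass f A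
  mass-lower-∈ {i = i} {x} {f} {A} i∈A =
    trans (+-congˡ (sym (restrict-yes (i ∈? A) i∈A))) (mass-lower i x f A)

  mass-lower-∉ : ∀ {n} {i : Fin n} {x f A} → i ∉ A → mass (lower i x f) A ≈ mass f A
  mass-lower-∉ {i = i} {x} {f} {A} i∉A = trans (sym (+-identityʳ _))
    (trans (+-congˡ (sym (restrict-no (i ∈? A) i∉A))) (mass-lower i x f A))

  -- A transportation theorem: Hall's condition yields a plan.

  module _ {m n : ℕ} where

    Closed : List (Fin m × Fin n) → Subset m → Subset n → Set
    Closed es A B = All (λ (i , j) → i ∈ A → j ∈ B) es

    closed? : ∀ es A B → Dec (Closed es A B)
    closed? es A B = All.all? (λ (i , j) → (i ∈? A) →-dec (j ∈? B)) es

    closed-∪ : ∀ {es A A′ B B′} → Closed es A B → Closed es A′ B′ → Closed es (A ∪ A′) (B ∪ B′)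
    closed-∪ c c′ = All.zipWith
      (λ (f , f′) → x∈p∪q⁺ ∘ [ inj₁ ∘ f , inj₂ ∘ f′ ] ∘ x∈p∪q⁻ _ _) (c , c′)

    closed-∩ : ∀ {es A A′ B B′} → Closed es A B → Closed es A′ B′ → Closed es (A ∩ A′) (B ∩ B′)
    closed-∩ c c′ = All.zipWith
      (λ (f , f′) i∈ → let (i∈A , i∈A′) = x∈p∩q⁻ _ _ i∈ in x∈p∩q⁺ (f i∈A , f′ i∈A′)) (c , c′)

    closed-∅ : ∀ es {B} → Closed es ∅ B
    closed-∅ es = All.universal (λ _ i∈∅ → contradiction i∈∅ ∉⊥) es

    -- Asked of every closed pair, not only of `A` with its exact neighbourhood: closed pairs are
    -- stable under union and intersection, as uncrossing requires.
    Hall : List (Fin m × Fin n) → (Fin m → ℝ) → (Fin n → ℝ) → Set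
    Hall es p q = ∀ A B → Closed es A B → mass p A ≤ mass q B

    -- The pair `∅ , ⁅ j ⁆` is always closed, so nonnegativity of the sinks travels through the
    -- induction inside `Hall`.
    hall-nonneg : ∀ {es p q} → Hall es p q → ∀ j → 0# ≤ q j
    hall-nonneg {es} {p} {q} hall j = begin
      0#            ≈⟨ mass-∅ p ⟨
      mass p ∅      ≤⟨ hall ∅ ⁅ j ⁆ (closed-∅ es) ⟩
      mass q ⁅ j ⁆  ≈⟨ mass-⁅⁆ q j ⟩
      q j           ∎

    record Transport (es : List (Fin m × Fin n)) (p : Fin m → ℝ) (q : Fin n → ℝ) : Set where
      field
        plan    : Fin m → Fin n → ℝ
        nonneg  : ∀ i j → 0# ≤ plan i j
        support : ∀ i j → (i , j) ∉ᴸ es → plan i j ≈ 0#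
        rows    : ∀ i → sum (plan i) ≈ p i
        columns : ∀ j → sum (flip plan j) ≤ q j

    module Step (i₀ : Fin m) (j₀ : Fin n) (es : List (Fin m × Fin n))
                (p : Fin m → ℝ) (q : Fin n → ℝ)
                (0≤p : ∀ i → 0# ≤ p i) (hall : Hall ((i₀ , j₀) ∷ es) p q) where

      -- The closed pairs that lose slack when flow is sent from `i₀` to `j₀`: the mass of `B` drops
      -- and that of `A` does not.
      Crossing : Pred (Subset m × Subset n) 0ℓ
      Crossing (A , B) = Closed ((i₀ , j₀) ∷ es) A B × i₀ ∉ A × j₀ ∈ B

      crossing? : Decidable Crossing
      crossing? (A , B) = closed? _ A B ×-dec ¬? (i₀ ∈? A) ×-dec (j₀ ∈? B)

      slack : Subset m × Subset n → ℝ
      slack (A , B) = mass q B - mass p A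

      cuts : List (Subset m × Subset n)
      cuts = filter crossing? (cartesianProduct (subsets m) (subsets n))

      trivial tightest : Subset m × Subset n
      -- The default value of `argmin`; it is crossing itself, so that the minimiser is crossing in
      -- every case.
      trivial  = ∅ , ⁅ j₀ ⁆
      tightest = argmin slack trivial cuts

      trivial-crossing : Crossing trivial
      trivial-crossing = closed-∅ _ , ∉⊥ , x∈⁅x⁆ j₀

      tightest-crossing : Crossing tightest
      tightest-crossing = argmin-all slack {P = Crossing} trivial-crossing
        (All.all-filter crossing? (cartesianProduct (subsets m) (subsets n)))

      tightest-least : ∀ {c} → Crossing c → slack tightest ≤ slack c
      tightest-least {A , B} crossing =
        All.lookup (f[argmin]≤f[xs] {f = slack} trivial cuts)
          (∈-filter⁺ crossing? (∈-cartesianProduct⁺ (∈-subsets A) (∈-subsets B)) crossing)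

      module _ (x : ℝ) where

        p′ : Fin m → ℝ
        p′ = lower i₀ x p

        q′ : Fin n → ℝ
        q′ = lower j₀ x q

        -- Both masses drop by `x` or neither does, except at crossing cuts; those have slack at
        -- least that of `tightest`, hence at least `x`.
        hall-lower : x ≤ slack tightest → Hall ((i₀ , j₀) ∷ es) p′ q′
        hall-lower x≤slack A B closed with i₀ ∈? A | j₀ ∈? B
        ... | yes i₀∈A | no j₀∉B  = contradiction (All.head closed i₀∈A) j₀∉B
        ... | yes i₀∈A | yes j₀∈B = +-cancelʳ-≤ x (begin
          mass p′ A + x  ≈⟨ mass-lower-∈ i₀∈A ⟩
          mass p A       ≤⟨ hall A B closed ⟩
          mass q B       ≈⟨ mass-lower-∈ j₀∈B ⟨
          mass q′ B + x  ∎)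
        ... | no i₀∉A  | no j₀∉B  = begin
          mass p′ A      ≈⟨ mass-lower-∉ i₀∉A ⟩
          mass p A       ≤⟨ hall A B closed ⟩
          mass q B       ≈⟨ mass-lower-∉ j₀∉B ⟨
          mass q′ B      ∎
        ... | no i₀∉A  | yes j₀∈B = +-cancelʳ-≤ x (begin
          mass p′ A + x              ≈⟨ +-congʳ (mass-lower-∉ i₀∉A) ⟩
          mass p A + x               ≤⟨ +-monoʳ-≤ _ (≤-trans x≤slack
                                            (tightest-least (closed , i₀∉A , j₀∈B))) ⟩
          mass p A + slack (A , B)   ≈⟨ +-comm _ _ ⟩
          slack (A , B) + mass p A   ≈⟨ //-rightDividesˡ _ _ ⟩
          mass q B                   ≈⟨ mass-lower-∈ j₀∈B ⟨
          mass q′ B + x              ∎)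

        -- With nothing left at `i₀`, removing it from `A` costs no mass and makes the condition at
        -- the edge `(i₀ , j₀)` vacuous.
        exhausted : p′ i₀ ≈ 0# → Hall ((i₀ , j₀) ∷ es) p′ q′ → Hall es p′ q′
        exhausted p′i₀≈0 hall′ A B closed = begin
          mass p′ A                  ≈⟨ sum-cong-≋ (λ i → pointwise i (i Fin.≟ i₀)) ⟩
          mass p′ (A ∩ ∁ ⁅ i₀ ⁆)     ≤⟨ hall′ (A ∩ ∁ ⁅ i₀ ⁆) B
            (i₀-avoided ∷ All.map (_∘ proj₁ ∘ x∈p∩q⁻ _ _) closed) ⟩
          mass q′ B                  ∎
          where
          i₀-avoided : i₀ ∈ A ∩ ∁ ⁅ i₀ ⁆ → j₀ ∈ B
          i₀-avoided i₀∈ = contradiction (x∈⁅x⁆ i₀) (x∈∁p⇒x∉p (proj₂ (x∈p∩q⁻ A _ i₀∈)))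

          pointwise : ∀ i → Dec (i ≡ i₀) →
            restrict (i ∈? A) (p′ i) ≈ restrict (i ∈? A ∩ ∁ ⁅ i₀ ⁆) (p′ i)
          pointwise i (yes ≡.refl) = trans (vanishes (i ∈? A)) (sym (vanishes (i ∈? A ∩ ∁ ⁅ i ⁆)))
            where
            vanishes : ∀ {X} (x? : Dec X) → restrict x? (p′ i₀) ≈ 0#
            vanishes x? = trans (restrict-cong x? p′i₀≈0) (restrict-zero x?)
          pointwise i (no i≢i₀) = restrict-⇔
            (mk⇔ (λ i∈A → x∈p∩q⁺ (i∈A , x∉p⇒x∈∁p (i≢i₀ ∘ x∈⁅y⁆⇒x≡y i₀)))
                 (proj₁ ∘ x∈p∩q⁻ _ _))
            (i ∈? A) (i ∈? A ∩ ∁ ⁅ i₀ ⁆)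

        -- The union contains j₀ and the intersection avoids i₀, so both are closed
        -- under (i₀ , j₀) even if A , B is not.
        uncross : ∀ {A* B*} → Crossing (A* , B*) → mass q′ B* ≤ mass p′ A* →
                  Hall ((i₀ , j₀) ∷ es) p′ q′ → Hall es p′ q′
        uncross {A*} {B*} (_ ∷ closed* , i₀∉A* , j₀∈B*) tight hall′ A B closed =
          +-cancelʳ-≤ (mass q′ B*) (begin
            mass p′ A + mass q′ B*                 ≤⟨ +-monoʳ-≤ _ tight ⟩
            mass p′ A + mass p′ A*                 ≈⟨ mass-∪-∩ p′ A A* ⟩
            mass p′ (A ∪ A*) + mass p′ (A ∩ A*)    ≤⟨ +-mono-≤
              (hall′ _ _ ((λ _ → x∈p∪q⁺ (inj₂ j₀∈B*)) ∷ closed-∪ closed closed*))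
              (hall′ _ _ ((λ i₀∈ → contradiction (proj₂ (x∈p∩q⁻ A A* i₀∈)) i₀∉A*)
                          ∷ closed-∩ closed closed*)) ⟩
            mass q′ (B ∪ B*) + mass q′ (B ∩ B*)    ≈⟨ mass-∪-∩ q′ B B* ⟨
            mass q′ B + mass q′ B*                 ∎)

      -- Shipping as much as possible along (i₀ , j₀) either exhausts i₀ or makes a
      -- cut tight; in both cases the edge is no longer needed.
      record Shipment : Set where
        field
          amount          : ℝ
          amount-nonneg   : 0# ≤ amount
          amount-≤        : amount ≤ p i₀
          hall-tail       : Hall es (p′ amount) (q′ amount)

      shipment : Shipment
      -- `hall-lower` is abstracted along with `tightest`, so that its bound speaks of the named cut
      -- `A* , B*`.
      shipment with tightest | tightest-crossing | hall-lower
      ... | A* , B* | crossing@(closed* , i₀∉A* , j₀∈B*) | hall-lower*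
        with ≤-total (p i₀) (slack (A* , B*))
      ...   | inj₁ p≤slack = record
        { amount        = p i₀
        ; amount-nonneg = 0≤p i₀
        ; amount-≤ = ≤-refl
        ; hall-tail     = exhausted (p i₀) p′≈0 (hall-lower* (p i₀) p≤slack)
        }
        where
        p′≈0 : p′ (p i₀) i₀ ≈ 0#
        p′≈0 = x≈y⇒x∙y⁻¹≈ε (sym (restrict-yes (i₀ Fin.≟ i₀) ≡.refl))
      ...   | inj₂ slack≤p = record
        { amount        = x
        ; amount-nonneg = x≤y⇒0≤y-x (hall A* B* closed*)
        ; amount-≤ = slack≤p
        ; hall-tail     = uncross x crossing tight (hall-lower* x ≤-refl)
        }
        where
        x : ℝ
        x = slack (A* , B*)

        tight : mass (q′ x) B* ≤ mass (p′ x) A*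
        tight = +-cancelʳ-≤ x (begin
          mass (q′ x) B* + x       ≈⟨ mass-lower-∈ j₀∈B* ⟩
          mass q B*                ≈⟨ //-rightDividesˡ _ _ ⟨
          x + mass p A*            ≈⟨ +-comm _ _ ⟩
          mass p A* + x            ≈⟨ +-congʳ (mass-lower-∉ i₀∉A*) ⟨
          mass (p′ x) A* + x       ∎)

    -- Induction on the edges: the shipment along the first one is added to a plan for the lowered
    -- supplies and capacities on the others.
    transport : ∀ es {p q} → (∀ i → 0# ≤ p i) → Hall es p q → Transport es p q
    transport [] {p} {q} 0≤p hall = record
      { plan    = λ _ _ → 0#
      ; nonneg  = λ _ _ → ≤-refl
      ; support = λ _ _ _ → refl
      ; rows    = λ i → trans (sum-replicate-zero n) (≤-antisym (0≤p i) (p≤0 i))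
      ; columns = λ j → ≤-trans (≤-reflexive (sum-replicate-zero m)) (hall-nonneg {[]} {p} hall j)
      }
      where
      -- Without edges `⁅ i ⁆ , ∅` is closed, so no supply remains and the zero plan has the right
      -- rows.
      p≤0 : ∀ i → p i ≤ 0#
      p≤0 i = begin
        p i           ≈⟨ mass-⁅⁆ p i ⟨
        mass p ⁅ i ⁆  ≤⟨ hall ⁅ i ⁆ ∅ [] ⟩
        mass q ∅      ≈⟨ mass-∅ q ⟩
        0#            ∎
    transport ((i₀ , j₀) ∷ es) {p} {q} 0≤p hall = record
      { plan    = λ i j → rest.plan i j + extra i j
      ; nonneg  = λ i j → ≤-trans (rest.nonneg i j) (x≤x+y
          (restrict-nonneg (i₀ Fin.≟ i) (restrict-nonneg (j₀ Fin.≟ j) amount-nonneg)))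
      ; support = λ i j ij∉ → trans
          (+-cong (rest.support i j (ij∉ ∘ there)) (extra-support i j (ij∉ ∘ here)))
          (+-identityʳ 0#)
      ; rows    = λ i → trans (∑-distrib-+ {n} _ _)
          (trans (+-cong (rest.rows i) (extra-rows i)) (lower-+ i₀ amount p i))
      ; columns = λ j → ≤-trans (≤-reflexive (∑-distrib-+ {m} _ _)) (≤-trans
          (+-mono-≤ (rest.columns j) (≤-reflexive (sum-point i₀ _)))
          (≤-reflexive (lower-+ j₀ amount q j)))
      }
      where
      open Step i₀ j₀ es p q 0≤p hall
      open Shipment shipment

      extra : Fin m → Fin n → ℝ
      extra i j = point i₀ (point j₀ amount j) i

      extra-support : ∀ i j → ¬ (i , j) ≡ (i₀ , j₀) → extra i j ≈ 0#
      extra-support i j ij≢ with i₀ Fin.≟ i | j₀ Fin.≟ j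
      ... | yes ≡.refl | yes ≡.refl = contradiction ≡.refl ij≢
      ... | yes _      | no _       = refl
      ... | no _       | _          = refl

      extra-rows : ∀ i → sum (extra i) ≈ point i₀ amount i
      extra-rows i = trans (sym (restrict-sum (i₀ Fin.≟ i) (point j₀ amount)))
        (restrict-cong (i₀ Fin.≟ i) (sum-point j₀ amount))

      p′-nonneg : ∀ i → 0# ≤ p′ amount i
      p′-nonneg i = x≤y⇒0≤y-x (point-≤ (i₀ Fin.≟ i))
        where
        point-≤ : (i₀≟i : Dec (i₀ ≡ i)) → restrict i₀≟i amount ≤ p i
        point-≤ (yes ≡.refl) = amount-≤
        point-≤ (no _)       = 0≤p i

      module rest = Transport (transport es p′-nonneg hall-tail)

-- Products of finite sets.

_×ᶠ_ : FiniteSet → FiniteSet → FiniteSet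
S ×ᶠ T = record
  { Elem = Elem S × Elem T
  ; size = size S ℕ.* size T
  ; enum = ↔-sym Fin.*↔× ↔-∘ (FiniteSet.enum S ×-↔ FiniteSet.enum T)
  }

index-element : ∀ S i → index S (element S i) ≡ i
index-element S = Inverse.strictlyInverseˡ (FiniteSet.enum S)

≟-Elem : ∀ S → DecidableEquality (Elem S)
≟-Elem S = Fin.inj⇒≟ (↔⇒↣ (FiniteSet.enum S))

-- Sums and probabilities over finite sets.

module Decomposition (reals : Reals) where
  open OrderedField reals
  open Theory reals

  ∑-cong : ∀ S {f g : Elem S → ℝ} → (∀ s → f s ≈ g s) → ∑ S f ≈ ∑ S g
  ∑-cong S f≈g = sum-cong-≋ (f≈g ∘ element S)

  ∑-mono : ∀ S {f g : Elem S → ℝ} → (∀ s → f s ≤ g s) → ∑ S f ≤ ∑ S g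
  ∑-mono S f≤g = sum-mono (f≤g ∘ element S)

  ∑-nonneg : ∀ S {f : Elem S → ℝ} → (∀ s → 0# ≤ f s) → 0# ≤ ∑ S f
  ∑-nonneg S 0≤f = sum-nonneg (0≤f ∘ element S)

  ∑-+ : ∀ S (f g : Elem S → ℝ) → ∑ S (λ s → f s + g s) ≈ ∑ S f + ∑ S g
  ∑-+ S f g = ∑-distrib-+ (f ∘ element S) (g ∘ element S)

  ∑-swap : ∀ S T (f : Elem S → Elem T → ℝ) →
           ∑ S (λ s → ∑ T (f s)) ≈ ∑ T (λ t → ∑ S (flip f t))
  ∑-swap S T f = ∑-comm λ i j → f (element S i) (element T j)

  ∑-× : ∀ S T (f : Elem S × Elem T → ℝ) → ∑ (S ×ᶠ T) f ≈ ∑ S (λ s → ∑ T (λ t → f (s , t)))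
  ∑-× S T f = trans (sum-combine (size S) _)
    (sum-cong-≋ λ i → sum-cong-≋ λ j → reflexive
      (≡.cong (λ (i , j) → f (element S i , element T j)) (Fin.remQuot-combine i j)))

  ∑-restrict-zero : ∀ S {A : Pred (Elem S) 0ℓ} (A? : Decidable A) →
                    ∑ S (λ s → restrict (A? s) 0#) ≈ 0#
  ∑-restrict-zero S A? = sum-zero {size S} (restrict-zero ∘ A? ∘ element S)

  ∑-restrict-+ : ∀ S {A : Pred (Elem S) 0ℓ} (A? : Decidable A) (f g : Elem S → ℝ) →
    ∑ S (λ s → restrict (A? s) (f s + g s)) ≈
    ∑ S (f ↾ A?) + ∑ S (g ↾ A?)
  ∑-restrict-+ S A? f g = trans (∑-cong S λ s → restrict-+ (A? s) (f s) (g s))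
    (∑-+ S (f ↾ A?) (g ↾ A?))

  module _ {S : FiniteSet} (μ : Distr S) where

    Pr-mono : {A B : Pred (Elem S) 0ℓ} (A? : Decidable A) (B? : Decidable B) →
              (∀ s → A s → B s) → Pr μ A? ≤ Pr μ B?
    Pr-mono A? B? A⊆B = ∑-mono S λ s → restrict-mono (A? s) (B? s) (A⊆B s) (nonneg μ s)

    Pr-inj₁ : ∀ {T} {A : Pred (Elem S ⊎ Elem T) 0ℓ} (A? : Decidable A) →
              Pr (inj₁-distr {T = T} μ) A? ≈ Pr μ (A? ∘ inj₁)
    Pr-inj₁ {T} A? = trans (∑-⊎ S T (prob (inj₁-distr {T = T} μ) ↾ A?))
      (trans (+-congˡ (∑-restrict-zero T (A? ∘ inj₂))) (+-identityʳ _))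

    Pr-inj₂ : ∀ {T} {A : Pred (Elem T ⊎ Elem S) 0ℓ} (A? : Decidable A) →
              Pr (inj₂-distr {S = T} μ) A? ≈ Pr μ (A? ∘ inj₂)
    Pr-inj₂ {T} A? = trans (∑-⊎ T S (prob (inj₂-distr {S = T} μ) ↾ A?))
      (trans (+-congʳ (∑-restrict-zero T (A? ∘ inj₁))) (+-identityˡ _))

  -- The bisimulation inequality with the image of `A` replaced by an arbitrary decidable `B`
  -- containing it. By monotonicity this is the same condition for decidable `C`, and it keeps
  -- decision procedures for images out of the argument.
  Approximates : ∀ {S T} → (Elem S → Elem T → Set) → ℝ → Distr S → Distr T → Set₁
  Approximates {S} {T} C ε μ ν = ∀ {A B} (A? : Decidable A) (B? : Decidable B) →
    (∀ {s t} → A s → C s t → B t) → Pr μ A? ≤ Pr ν B? + ε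

  -- Partial couplings from the transportation theorem.

  record PartialCoupling {S T : FiniteSet} (C : Elem S → Elem T → Set) (ε : ℝ)
                         (μ : Distr S) (ν : Distr T) : Set where
    field
      plan          : Elem S → Elem T → ℝ
      excess        : Elem S → ℝ
      plan-nonneg   : ∀ s t → 0# ≤ plan s t
      excess-nonneg : ∀ s → 0# ≤ excess s
      support       : ∀ {s t} → ¬ C s t → plan s t ≈ 0#
      rows          : ∀ s → ∑ T (plan s) + excess s ≈ prob μ s
      columns       : ∀ t → ∑ S (flip plan t) ≤ prob ν t
      ∑-excess      : ∑ S excess ≤ ε

  module _ {S T : FiniteSet} {C : Elem S → Elem T → Set} (C? : ∀ s t → Dec (C s t))
           {ε : ℝ} (0≤ε : 0# ≤ ε) {μ : Distr S} {ν : Distr T} where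

    -- Row 0 of the sinks is an overflow of capacity ε, open to every source.
    Edge : Fin (size S) → Fin (suc (size T)) → Set
    Edge i zero    = ⊤
    Edge i (suc j) = C (element S i) (element T j)

    edge? : ∀ i j → Dec (Edge i j)
    edge? i zero    = yes tt
    edge? i (suc j) = C? (element S i) (element T j)

    edges : List (Fin (size S) × Fin (suc (size T)))
    edges = filter (uncurry edge?) (cartesianProduct (allFin _) (allFin _))

    supply : Fin (size S) → ℝ
    supply = prob μ ∘ element S

    capacity : Fin (suc (size T)) → ℝ
    capacity zero    = ε
    capacity (suc j) = prob ν (element T j)

    ∈-edges : ∀ {i j} → Edge i j → (i , j) ∈ᴸ edges
    ∈-edges = ∈-filter⁺ (uncurry edge?) (∈-cartesianProduct⁺ (∈-allFin _) (∈-allFin _))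

    -- Every source has an edge to the overflow, so a closed pair without the overflow in `B` has
    -- `A` empty. With the overflow in `B`, Hall's inequality is the hypothesis, its ε being the
    -- overflow's capacity.
    hall : Approximates C ε μ ν → Hall edges supply capacity
    hall approx A B closed with zero ∈? B
    ... | no 0∉B  = begin
      mass supply A  ≈⟨ sum-zero {size S} (λ i → restrict-no (i ∈? A)
                          (0∉B ∘ All.lookup closed (∈-edges {i} tt))) ⟩
      0#             ≤⟨ sum-nonneg (λ j →
                          restrict-nonneg (suc j ∈? B) (nonneg ν (element T j))) ⟩
      tail           ≈⟨ +-identityˡ tail ⟨
      0# + tail      ∎
      where
      tail : ℝ
      tail = sum (λ j → restrict (suc j ∈? B) (capacity (suc j)))
    ... | yes 0∈B = begin
      mass supply A  ≈⟨ sum-cong-≋ (λ i → reflexive (≡.cong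
                          (λ k → restrict (k ∈? A) (supply i)) (index-element S i))) ⟨
      Pr μ A?        ≤⟨ approx A? B? closed′ ⟩
      Pr ν B? + ε    ≈⟨ +-comm _ _ ⟩
      ε + Pr ν B?    ≈⟨ +-congˡ (sum-cong-≋ (λ j → reflexive (≡.cong
                          (λ k → restrict (suc k ∈? B) (capacity (suc j))) (index-element T j)))) ⟩
      ε + sum (λ j → restrict (suc j ∈? B) (capacity (suc j)))  ∎
      where
      A? : Decidable (λ s → index S s ∈ A)
      A? s = index S s ∈? A

      B? : Decidable (λ t → suc (index T t) ∈ B)
      B? t = suc (index T t) ∈? B

      closed′ : ∀ {s t} → index S s ∈ A → C s t → suc (index T t) ∈ B
      closed′ {s} {t} s∈A c = All.lookup closed (∈-edges
        (≡.subst₂ C (≡.sym (element-index S s)) (≡.sym (element-index T t)) c)) s∈A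

    couple : Approximates C ε μ ν → PartialCoupling C ε μ ν
    couple approx = record
      { plan          = λ s t → plan (index S s) (suc (index T t))
      -- The flow into the overflow; the capacity of that sink bounds its total by ε.
      ; excess        = λ s → plan (index S s) zero
      ; plan-nonneg   = λ s t → nonneg′ _ _
      ; excess-nonneg = λ s → nonneg′ _ _
      ; support       = λ {s} {t} ¬c → support _ _ (¬c ∘ edge⇒C ∘ proj₂ ∘
          ∈-filter⁻ (uncurry edge?) {xs = cartesianProduct (allFin _) (allFin _)})
      ; rows          = λ s → trans (+-comm _ _) (trans
          (+-congˡ (sum-cong-≋ λ j →
            reflexive (≡.cong (plan (index S s) ∘ suc) (index-element T j))))
          (trans (rows (index S s)) (reflexive (≡.cong (prob μ) (element-index S s)))))
      ; columns       = λ t → begin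
          ∑ S (λ s → plan (index S s) (suc (index T t)))  ≈⟨ ∑-index (flip plan _) ⟩
          sum (λ i → plan i (suc (index T t)))            ≤⟨ columns (suc (index T t)) ⟩
          prob ν (element T (index T t))                  ≡⟨ ≡.cong (prob ν) (element-index T t) ⟩
          prob ν t                                        ∎
      ; ∑-excess      = ≤-trans (≤-reflexive (∑-index (λ i → plan i zero))) (columns zero)
      }
      where
      open Transport (transport edges {q = capacity} (nonneg μ ∘ element S) (hall approx))
        renaming (nonneg to nonneg′)

      edge⇒C : ∀ {s t} → Edge (index S s) (suc (index T t)) → C s t
      edge⇒C {s} {t} = ≡.subst₂ C (element-index S s) (element-index T t)

      ∑-index : ∀ f → ∑ S (f ∘ index S) ≈ sum f
      ∑-index f = sum-cong-≋ (reflexive ∘ ≡.cong f ∘ index-element S)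

  -- The distribution on pairs and bare copies given by a coupling.

  Left : ∀ S T → (Elem S → Elem T → Set) → Elem S → Elem ((S ×ᶠ T) ⊎ᶠ T) → Set
  Left S T C s = [ (λ (a , b) → s ≡ a × C a b) , const ⊥ ]

  module _ {S T : FiniteSet} {C : Elem S → Elem T → Set} {ε : ℝ}
           {μ : Distr S} {ν : Distr T} (π : PartialCoupling C ε μ ν) where
    open PartialCoupling π

    unmatched : Elem T → ℝ
    unmatched t = prob ν t - ∑ S (flip plan t)

    weight : Elem ((S ×ᶠ T) ⊎ᶠ T) → ℝ
    weight = [ uncurry plan , unmatched ]

    weight-nonneg : ∀ x → 0# ≤ weight x
    weight-nonneg = [ uncurry plan-nonneg , x≤y⇒0≤y-x ∘ columns ]

    ∑-weight : ∀ {A : Pred (Elem ((S ×ᶠ T) ⊎ᶠ T)) 0ℓ} (A? : Decidable A) →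
      ∑ ((S ×ᶠ T) ⊎ᶠ T) (λ x → restrict (A? x) (weight x)) ≈
      ∑ S (λ s → ∑ T (λ t → restrict (A? (inj₁ (s , t))) (plan s t))) +
      ∑ T (λ t → restrict (A? (inj₂ t)) (unmatched t))
    ∑-weight A? = trans (∑-⊎ (S ×ᶠ T) T (weight ↾ A?))
      (+-congʳ (∑-× S T (uncurry plan ↾ (A? ∘ inj₁))))

    -- Column `t` of the plan and the unmatched mass at `t` add up to `prob ν t` by the choice of
    -- `unmatched`. This exactness gives total one below and strong bisimilarity with `N` later.
    ∑-weight-marginal : ∀ {B : Pred (Elem T) 0ℓ} (B? : Decidable B) →
      ∑ ((S ×ᶠ T) ⊎ᶠ T) (λ x → restrict (B? ([ proj₂ , id ] x)) (weight x)) ≈ Pr ν B?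
    ∑-weight-marginal B? = begin-equality
      ∑ ((S ×ᶠ T) ⊎ᶠ T) (λ x → restrict (B? ([ proj₂ , id ] x)) (weight x))
        ≈⟨ ∑-weight (B? ∘ [ proj₂ , id ]) ⟩
      ∑ S (λ s → ∑ T (λ t → restrict (B? t) (plan s t))) + u
        ≈⟨ +-congʳ (∑-swap S T λ s t → restrict (B? t) (plan s t)) ⟩
      ∑ T (λ t → ∑ S (λ s → restrict (B? t) (plan s t))) + u
        ≈⟨ +-congʳ (∑-cong T (λ t → restrict-sum (B? t) (flip plan t ∘ element S))) ⟨
      ∑ T (λ t → restrict (B? t) (∑ S (flip plan t))) + u
        ≈⟨ ∑-restrict-+ T B? (λ t → ∑ S (flip plan t)) unmatched ⟨
      ∑ T (λ t → restrict (B? t) (∑ S (flip plan t) + unmatched t))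
        ≈⟨ ∑-cong T (λ t → restrict-cong (B? t)
             (trans (+-comm _ _) (//-rightDividesˡ (∑ S (flip plan t)) (prob ν t)))) ⟩
      Pr ν B? ∎
      where
      u : ℝ
      u = ∑ T (λ t → restrict (B? t) (unmatched t))

    coupled : Distr ((S ×ᶠ T) ⊎ᶠ T)
    coupled = record
      { prob   = weight
      ; nonneg = weight-nonneg
      ; total  = trans (∑-weight-marginal (λ _ → yes tt)) (total ν)
      }

    -- The matched mass `p` is completed to one by the unmatched mass on one side and by the excess
    -- on the other, so the two have the same total. This turns the one-sided hypothesis into a
    -- bound for the reverse direction.
    ∑-unmatched : ∑ T unmatched ≤ ε
    ∑-unmatched = +-cancelʳ-≤ p (begin
      ∑ T unmatched + p                       ≈⟨ +-comm _ _ ⟩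
      p + ∑ T unmatched                       ≈⟨ ∑-weight (λ _ → yes tt) ⟨
      ∑ ((S ×ᶠ T) ⊎ᶠ T) weight                ≈⟨ total coupled ⟩
      1#                                      ≈⟨ total μ ⟨
      ∑ S (prob μ)                            ≈⟨ ∑-cong S rows ⟨
      ∑ S (λ s → ∑ T (plan s) + excess s)     ≈⟨ ∑-+ S (λ s → ∑ T (plan s)) excess ⟩
      p + ∑ S excess                          ≤⟨ +-monoʳ-≤ p ∑-excess ⟩
      p + ε                                   ≈⟨ +-comm _ _ ⟩
      ε + p                                   ∎)
      where
      p : ℝ
      p = ∑ S (λ s → ∑ T (plan s))

    module _ (C? : ∀ s t → Dec (C s t)) where

      -- The error is the excess alone: matched mass leaving `A` lands on pairs in `B`, and copies,
      -- which `Left` relates to nothing, can only increase the right-hand side.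
      coupled-approximates : Approximates (Left S T C) ε μ coupled
      coupled-approximates {A} {B} A? B? closed = begin
        ∑ S (λ s → restrict (A? s) (prob μ s))
          ≈⟨ ∑-cong S (λ s → restrict-cong (A? s) (rows s)) ⟨
        ∑ S (λ s → restrict (A? s) (∑ T (plan s) + excess s))
          ≈⟨ ∑-restrict-+ S A? (λ s → ∑ T (plan s)) excess ⟩
        ∑ S (λ s → restrict (A? s) (∑ T (plan s))) + ∑ S (λ s → restrict (A? s) (excess s))
          ≤⟨ +-mono-≤ (∑-mono S row) (≤-trans
               (∑-mono S (λ s → restrict-≤ (A? s) (excess-nonneg s))) ∑-excess) ⟩
        ∑ S (λ s → ∑ T (λ t → restrict (B? (inj₁ (s , t))) (plan s t))) + ε
          ≤⟨ +-monoˡ-≤ ε (x≤x+y (∑-nonneg T λ t →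
               restrict-nonneg (B? (inj₂ t)) (weight-nonneg (inj₂ t)))) ⟩
        ∑ S (λ s → ∑ T (λ t → restrict (B? (inj₁ (s , t))) (plan s t))) +
        ∑ T (λ t → restrict (B? (inj₂ t)) (unmatched t)) + ε
          ≈⟨ +-congʳ (∑-weight B?) ⟨
        Pr coupled B? + ε ∎
        where
        -- Off `C` the plan vanishes, so `closed` covers every pair that carries mass.
        cell : ∀ s → A s → ∀ t → plan s t ≤ restrict (B? (inj₁ (s , t))) (plan s t)
        cell s a t with C? s t
        ... | yes c = ≤-reflexive (sym (restrict-yes (B? (inj₁ (s , t))) (closed a (≡.refl , c))))
        ... | no ¬c = ≤-trans (≤-reflexive (support ¬c))
          (restrict-nonneg (B? (inj₁ (s , t))) (plan-nonneg s t))

        row : ∀ s → restrict (A? s) (∑ T (plan s)) ≤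
                    ∑ T (λ t → restrict (B? (inj₁ (s , t))) (plan s t))
        row s = restrict-least (A? s)
          (∑-nonneg T λ t → restrict-nonneg (B? (inj₁ (s , t))) (plan-nonneg s t))
          (λ a → ∑-mono T (cell s a))

      -- Here the error is the mass on copies, at most ε by `∑-unmatched`; what `B` holds in the row
      -- of `s` is at most `prob μ s`.
      approximates-coupled : Approximates (flip (Left S T C)) ε coupled μ
      approximates-coupled {B} {A} B? A? closed = begin
        Pr coupled B?
          ≈⟨ ∑-weight B? ⟩
        ∑ S (λ s → ∑ T (λ t → restrict (B? (inj₁ (s , t))) (plan s t))) +
        ∑ T (λ t → restrict (B? (inj₂ t)) (unmatched t))
          ≤⟨ +-mono-≤ (∑-mono S row) (≤-trans
               (∑-mono T (λ t → restrict-≤ (B? (inj₂ t)) (weight-nonneg (inj₂ t))))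
               ∑-unmatched) ⟩
        Pr μ A? + ε ∎
        where
        plan≤ : ∀ s → ∑ T (plan s) ≤ prob μ s
        plan≤ s = ≤-trans (x≤x+y (excess-nonneg s)) (≤-reflexive (rows s))

        cell : ∀ s t → restrict (B? (inj₁ (s , t))) (plan s t) ≤ restrict (A? s) (plan s t)
        cell s t = restrict-least (B? (inj₁ (s , t)))
          (restrict-nonneg (A? s) (plan-nonneg s t)) λ b → bound b (C? s t)
          where
          bound : B (inj₁ (s , t)) → Dec (C s t) → plan s t ≤ restrict (A? s) (plan s t)
          bound b (yes c) = ≤-reflexive (sym (restrict-yes (A? s) (closed b (≡.refl , c))))
          bound b (no ¬c) = ≤-trans (≤-reflexive (support ¬c))
            (restrict-nonneg (A? s) (plan-nonneg s t))

        row : ∀ s → ∑ T (λ t → restrict (B? (inj₁ (s , t))) (plan s t)) ≤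
                    restrict (A? s) (prob μ s)
        row s = begin
          ∑ T (λ t → restrict (B? (inj₁ (s , t))) (plan s t))
            ≤⟨ ∑-mono T (cell s) ⟩
          ∑ T (λ t → restrict (A? s) (plan s t))
            ≈⟨ restrict-sum (A? s) (plan s ∘ element T) ⟨
          restrict (A? s) (∑ T (plan s))
            ≤⟨ restrict-least (A? s) (restrict-nonneg (A? s) (nonneg μ s)) (λ a →
                 ≤-trans (plan≤ s) (≤-reflexive (sym (restrict-yes (A? s) a)))) ⟩
          restrict (A? s) (prob μ s) ∎

  -- Approximate bisimulations as pairs of simulations.

  record IsSimulation {AP : Set} {S T : FiniteSet} (ε δ : ℝ) (M : CTMC AP S) (N : CTMC AP T)
                      (C : Elem S → Elem T → Set) : Set₁ where
    private
      module M = CTMC M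
      module N = CTMC N
    field
      label : ∀ {s t} → C s t → M.L s ≐ N.L t
      rate  : ∀ {s t} → C s t → ∣ ln (M.E s) - ln (N.E t) ∣ ≤ δ
      step  : ∀ {s t} → C s t → Approximates C ε (M.P s) (N.P t)

  module _ {AP : Set} {S T : FiniteSet} {ε δ : ℝ} {M : CTMC AP S} {N : CTMC AP T} where

    module _ {R : Rel (Elem S ⊎ Elem T) 0ℓ} (bisim : IsApproxBisimulation ε δ (M ⊕ N) R) where
      open IsApproxBisimulation bisim

      bisimulation⇒simulation : IsSimulation ε δ M N (λ s t → R (inj₁ s) (inj₂ t))
      bisimulation⇒simulation = record
        { label = label
        ; rate  = rate
        ; step  = λ {s} {t} r {A} {B} A? B? closed →
            -- `A` seen as a set of states of the direct sum. From `inj₂ t` only states of `N` are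
            -- reached, and those in the image of this set lie in `B`.
            let A⁺? : Decidable [ A , const ⊥ ]
                A⁺? = λ { (inj₁ a) → A? a ; (inj₂ _) → no λ () }
                I?  = image? (S ⊎ᶠ T) R? A⁺?
            in begin
            Pr (CTMC.P M s) A?                   ≈⟨ Pr-inj₁ (CTMC.P M s) {T} A⁺? ⟨
            Pr (CTMC.P (M ⊕ N) (inj₁ s)) A⁺?     ≤⟨ step r _ A⁺? ⟩
            Pr (CTMC.P (M ⊕ N) (inj₂ t)) I? + ε  ≈⟨ +-congʳ (Pr-inj₂ (CTMC.P N t) {S} I?) ⟩
            Pr (CTMC.P N t) (I? ∘ inj₂) + ε      ≤⟨ +-monoˡ-≤ ε (Pr-mono (CTMC.P N t) (I? ∘ inj₂) B?
                                                   λ { b (inj₁ a , a∈A , r′) → closed a∈A r′ }) ⟩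
            Pr (CTMC.P N t) B? + ε               ∎
        }

    -- The least reflexive symmetric relation on the direct sum that contains `C`.
    Bridge : (Elem S → Elem T → Set) → Rel (Elem S ⊎ Elem T) 0ℓ
    Bridge C (inj₁ s) (inj₁ s′) = s ≡ s′
    Bridge C (inj₁ s) (inj₂ t)  = C s t
    Bridge C (inj₂ t) (inj₁ s)  = C s t
    Bridge C (inj₂ t) (inj₂ t′) = t ≡ t′

    module _ (0≤ε : 0# ≤ ε) (0≤δ : 0# ≤ δ)
             {C : Elem S → Elem T → Set} (C? : ∀ s t → Dec (C s t))
             (M≲N : IsSimulation ε δ M N C) (N≲M : IsSimulation ε δ N M (flip C)) where
      private
        module M≲N = IsSimulation M≲N
        module N≲M = IsSimulation N≲M
        P = CTMC.P (M ⊕ N)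

      bridge? : Binary.Decidable (Bridge C)
      bridge? (inj₁ s) (inj₁ s′) = ≟-Elem S s s′
      bridge? (inj₁ s) (inj₂ t)  = C? s t
      bridge? (inj₂ t) (inj₁ s)  = C? s t
      bridge? (inj₂ t) (inj₂ t′) = ≟-Elem T t t′

      bridge-refl : ∀ {u} → Bridge C u u
      bridge-refl {inj₁ _} = ≡.refl
      bridge-refl {inj₂ _} = ≡.refl

      bridge-sym : ∀ {u v} → Bridge C u v → Bridge C v u
      bridge-sym {inj₁ _} {inj₁ _} = ≡.sym
      bridge-sym {inj₁ _} {inj₂ _} = id
      bridge-sym {inj₂ _} {inj₁ _} = id
      bridge-sym {inj₂ _} {inj₂ _} = ≡.sym

      bridge-label : ∀ {u v} → Bridge C u v → CTMC.L (M ⊕ N) u ≐ CTMC.L (M ⊕ N) v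
      bridge-label {inj₁ _} {inj₁ _} ≡.refl = ≐-refl
      bridge-label {inj₁ _} {inj₂ _} c      = M≲N.label c
      bridge-label {inj₂ _} {inj₁ _} c      = N≲M.label c
      bridge-label {inj₂ _} {inj₂ _} ≡.refl = ≐-refl

      bridge-rate : ∀ {u v} → Bridge C u v →
                    ∣ ln (CTMC.E (M ⊕ N) u) - ln (CTMC.E (M ⊕ N) v) ∣ ≤ δ
      bridge-rate {inj₁ _} {inj₁ _} ≡.refl = ∣x-x∣≤y _ 0≤δ
      bridge-rate {inj₁ _} {inj₂ _} c      = M≲N.rate c
      bridge-rate {inj₂ _} {inj₁ _} c      = N≲M.rate c
      bridge-rate {inj₂ _} {inj₂ _} ≡.refl = ∣x-x∣≤y _ 0≤δ

      module _ {A : Pred (Elem S ⊎ Elem T) 0ℓ} (A? : Decidable A) where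

        I? : Decidable (Bridge C ⟦ A ⟧)
        I? = image? (S ⊎ᶠ T) bridge? A?

        stay : ∀ u → Pr (P u) A? ≤ Pr (P u) I? + ε
        stay u = ≤-trans (Pr-mono (P u) A? I? λ v a → v , a , bridge-refl {v}) (x≤x+y 0≤ε)

        bridge-step : ∀ {u v} → Bridge C u v → Pr (P u) A? ≤ Pr (P v) I? + ε
        bridge-step {inj₁ s} {inj₁ _} ≡.refl = stay (inj₁ s)
        bridge-step {inj₂ t} {inj₂ _} ≡.refl = stay (inj₂ t)
        bridge-step {inj₁ s} {inj₂ t} c = begin
          Pr (P (inj₁ s)) A?                ≈⟨ Pr-inj₁ (CTMC.P M s) {T} A? ⟩
          Pr (CTMC.P M s) (A? ∘ inj₁)       ≤⟨ M≲N.step c (A? ∘ inj₁) (I? ∘ inj₂)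
                                                 (λ a c′ → _ , a , c′) ⟩
          Pr (CTMC.P N t) (I? ∘ inj₂) + ε   ≈⟨ +-congʳ (Pr-inj₂ (CTMC.P N t) {S} I?) ⟨
          Pr (P (inj₂ t)) I? + ε            ∎
        bridge-step {inj₂ t} {inj₁ s} c = begin
          Pr (P (inj₂ t)) A?                ≈⟨ Pr-inj₂ (CTMC.P N t) {S} A? ⟩
          Pr (CTMC.P N t) (A? ∘ inj₂)       ≤⟨ N≲M.step c (A? ∘ inj₂) (I? ∘ inj₁)
                                                 (λ a c′ → _ , a , c′) ⟩
          Pr (CTMC.P M s) (I? ∘ inj₁) + ε   ≈⟨ +-congʳ (Pr-inj₁ (CTMC.P M s) {T} I?) ⟨
          Pr (P (inj₁ s)) I? + ε            ∎

      bridge : IsApproxBisimulation ε δ (M ⊕ N) (Bridge C)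
      bridge = record
        { R?          = bridge?
        ; reflexivity = λ {u} → bridge-refl {u}
        ; symmetry    = λ {u} {v} → bridge-sym {u} {v}
        ; label       = λ {u} {v} → bridge-label {u} {v}
        ; rate        = λ {u} {v} → bridge-rate {u} {v}
        ; step        = λ {u} {v} b A A? → bridge-step A? {u} {v} b
        }

  -- Strong bisimilarity along a projection.

  module _ {AP : Set} {S T : FiniteSet} (M : CTMC AP S) (N : CTMC AP T)
           (π : Elem S → Elem T) where
    private
      module M = CTMC M
      module N = CTMC N

    -- The bisimulation is the kernel of `fold`. Its classes are preimages of single states of `N`,
    -- so agreement of the marginals along `π` settles the transition condition.
    projection-∼ :
      (∀ s → M.L s ≐ N.L (π s)) → (∀ s → M.E s ≈ N.E (π s)) →
      (∀ s {B} (B? : Decidable B) → Pr (M.P s) (B? ∘ π) ≈ Pr (N.P (π s)) B?) →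
      π M.init ≡ N.init → M ∼ N
    projection-∼ label rate marginal init = _ , bisim , init
      where
      fold : Elem S ⊎ Elem T → Elem T
      fold = [ π , id ]

      fold-label : ∀ u → CTMC.L (M ⊕ N) u ≐ N.L (fold u)
      fold-label (inj₁ s) = label s
      fold-label (inj₂ t) = ≐-refl

      fold-rate : ∀ u → CTMC.E (M ⊕ N) u ≈ N.E (fold u)
      fold-rate (inj₁ s) = rate s
      fold-rate (inj₂ t) = refl

      fold-marginal : ∀ u {B} (B? : Decidable B) →
                      Pr (CTMC.P (M ⊕ N) u) (B? ∘ fold) ≈ Pr (N.P (fold u)) B?
      fold-marginal (inj₁ s) B? = trans (Pr-inj₁ (M.P s) {T} (B? ∘ fold)) (marginal s B?)
      fold-marginal (inj₂ t) B? = Pr-inj₂ (N.P t) {S} (B? ∘ fold)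

      bisim : IsStrongBisimulation (M ⊕ N) (λ u v → fold u ≡ fold v)
      bisim = record
        { R?            = λ u v → ≟-Elem T (fold u) (fold v)
        ; isEquivalence = record { refl = ≡.refl ; sym = ≡.sym ; trans = ≡.trans }
        ; label         = λ {u} {v} e → ≐-trans (fold-label u)
            (≐-trans (≡.subst (λ t → N.L (fold u) ≐ N.L t) e ≐-refl) (≐-sym (fold-label v)))
        ; rate          = λ {u} {v} e → trans (fold-rate u)
            (trans (reflexive (≡.cong N.E e)) (sym (fold-rate v)))
        ; step          = λ {u} {v} e c → let c? = ≟-Elem T (fold c) in
            trans (fold-marginal u c?)
              (trans (reflexive (≡.cong (λ t → Pr (N.P t) c?) e)) (sym (fold-marginal v c?)))
        }

  -- The two intermediate chains.

  module Construction {AP : Set} {S T : FiniteSet} {ε δ : ℝ} (0≤ε : 0# ≤ ε) (0≤δ : 0# ≤ δ)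
                      (M : CTMC AP S) (N : CTMC AP T) {C : Elem S → Elem T → Set}
                      (C? : ∀ s t → Dec (C s t)) (M≲N : IsSimulation ε δ M N C)
                      (init-related : C (CTMC.init M) (CTMC.init N)) where
    private
      module M = CTMC M
      module N = CTMC N
      module M≲N = IsSimulation M≲N

    -- inj₁ (s , t) couples s with t; inj₂ t is a copy of t, entered with the
    -- probability that the coupling leaves unmatched.  An unrelated pair (s , t) is
    -- unreachable and behaves like the copy of t.
    U : FiniteSet
    U = (S ×ᶠ T) ⊎ᶠ T

    π : Elem U → Elem T
    π = [ proj₂ , id ]

    coupling : ∀ {s t} → C s t → PartialCoupling {S} {T} C ε (M.P s) (N.P t)
    coupling c = couple C? 0≤ε (M≲N.step c)

    -- The coupling depends on the proof of `C s t`; always passing the decision `C? s t` fixes one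
    -- coupling per pair, shared by both chains.
    transition : ∀ {s t} → Dec (C s t) → Distr U
    transition         (yes c) = coupled (coupling c)
    transition {t = t} (no _) = inj₂-distr (N.P t)

    -- At an unrelated pair nothing bounds the distance between the rates of `s` and `t`, yet
    -- `M′∼N′` compares rates at every state, reachable or not; there the rate of `t` is the safe
    -- choice.
    exitRate : ∀ {s t} → Dec (C s t) → ℝ
    exitRate {s}     (yes _) = M.E s
    exitRate {t = t} (no _)  = N.E t

    exitRate-pos : ∀ {s t} (c? : Dec (C s t)) → 0# < exitRate c?
    exitRate-pos {s}     (yes _) = M.E-pos s
    exitRate-pos {t = t} (no _)  = N.E-pos t

    N′ : CTMC AP U
    N′ = record
      { P     = [ (λ (s , t) → transition (C? s t)) , inj₂-distr ∘ N.P ]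
      ; E     = N.E ∘ π
      ; E-pos = N.E-pos ∘ π
      ; init  = inj₁ (M.init , N.init)
      ; L     = N.L ∘ π
      }

    M′ : CTMC AP U
    M′ = record N′
      { E     = [ (λ (s , t) → exitRate (C? s t)) , N.E ]
      ; E-pos = [ (λ (s , t) → exitRate-pos (C? s t)) , N.E-pos ]
      }

    sameGraph : SameGraph M′ N′
    sameGraph = record
      { init-≡ = ≡.refl
      ; L-≐    = λ _ → ≐-refl
      ; edge-⇔ = λ _ _ → ⇔-id _
      }

    exitRate-close : ∀ {s t} (c? : Dec (C s t)) → ∣ ln (exitRate c?) - ln (N.E t) ∣ ≤ δ
    exitRate-close (yes c) = M≲N.rate c
    exitRate-close (no _)  = ∣x-x∣≤y _ 0≤δ

    M′-N′-rate : ∀ x → ∣ ln (CTMC.E M′ x) - ln (CTMC.E N′ x) ∣ ≤ δ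
    M′-N′-rate (inj₁ (s , t)) = exitRate-close (C? s t)
    M′-N′-rate (inj₂ t)       = ∣x-x∣≤y _ 0≤δ

    -- Equality on `U` serves as the relation, because transitions and labels coincide and each rate
    -- moves by at most δ in logarithm.
    M′∼N′ : M′ ∼[ 0# , δ ] N′
    M′∼N′ = _ , bridge ≤-refl 0≤δ (≟-Elem U) M′≲N′ N′≲M′ , ≡.refl
      where
      step : ∀ x → Approximates {U} {U} _≡_ 0# (CTMC.P N′ x) (CTMC.P N′ x)
      step x A? B? A⊆B = ≤-trans
        (Pr-mono (CTMC.P N′ x) A? B? (λ _ a → A⊆B a ≡.refl)) (x≤x+y ≤-refl)

      M′≲N′ : IsSimulation 0# δ M′ N′ _≡_
      M′≲N′ = record
        { label = λ { ≡.refl → ≐-refl }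
        ; rate  = λ { {x} ≡.refl → M′-N′-rate x }
        ; step  = λ { {x} ≡.refl → step x }
        }

      N′≲M′ : IsSimulation 0# δ N′ M′ (flip _≡_)
      N′≲M′ = record
        { label = λ { ≡.refl → ≐-refl }
        ; rate  = λ { {x} ≡.refl →
            ≤-trans (≤-reflexive (∣-∣-comm (ln (CTMC.E N′ x)) _)) (M′-N′-rate x) }
        ; step  = λ { {x} ≡.refl A? B? A⊆B → step x A? B? (λ { a ≡.refl → A⊆B a ≡.refl }) }
        }

    N′∼N : N′ ∼ N
    N′∼N = projection-∼ N′ N π (λ _ → ≐-refl) (λ _ → refl) marginal ≡.refl
      where
      transition-marginal : ∀ {s t} (c? : Dec (C s t)) {B} (B? : Decidable B) →
                            Pr (transition c?) (B? ∘ π) ≈ Pr (N.P t) B?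
      transition-marginal         (yes c) B? = ∑-weight-marginal (coupling c) B?
      transition-marginal {t = t} (no _)  B? = Pr-inj₂ (N.P t) {S ×ᶠ T} (B? ∘ π)

      marginal : ∀ x {B} (B? : Decidable B) → Pr (CTMC.P N′ x) (B? ∘ π) ≈ Pr (N.P (π x)) B?
      marginal (inj₁ (s , t)) B? = transition-marginal (C? s t) B?
      marginal (inj₂ t)       B? = Pr-inj₂ (N.P t) {S ×ᶠ T} (B? ∘ π)

    M∼M′ : M ∼[ ε , 0# ] M′
    M∼M′ = _ , bridge 0≤ε ≤-refl left? M≲M′ M′≲M , ≡.refl , init-related
      where
      left? : ∀ s x → Dec (Left S T C s x)
      left? s (inj₁ (a , b)) = ≟-Elem S s a ×-dec C? a b
      left? s (inj₂ _)       = no λ ()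

      label : ∀ {s} x → Left S T C s x → M.L s ≐ CTMC.L M′ x
      label (inj₁ _) (≡.refl , c) = M≲N.label c

      rate : ∀ {s} x → Left S T C s x → M.E s ≡ CTMC.E M′ x
      rate (inj₁ (s , t)) (≡.refl , c) with C? s t
      ... | yes _ = ≡.refl
      ... | no ¬c = contradiction c ¬c

      forth : ∀ {s} x → Left S T C s x →
              Approximates {S} {U} (Left S T C) ε (M.P s) (CTMC.P M′ x)
      forth (inj₁ (s , t)) (≡.refl , c) with C? s t
      -- The coupling in use comes from the decision's own proof `c′`, which may differ from `c`;
      -- the bound holds for every partial coupling.
      ... | yes c′ = coupled-approximates (coupling c′) C?
      ... | no ¬c  = contradiction c ¬c

      back : ∀ {s} x → Left S T C s x →
             Approximates {U} {S} (flip (Left S T C)) ε (CTMC.P M′ x) (M.P s)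
      back (inj₁ (s , t)) (≡.refl , c) with C? s t
      ... | yes c′ = approximates-coupled (coupling c′) C?
      ... | no ¬c  = contradiction c ¬c

      M≲M′ : IsSimulation ε 0# M M′ (Left S T C)
      M≲M′ = record
        { label = λ {_} {x} l → label x l
        ; rate  = λ {s} {x} l → ≡.subst (λ r → ∣ ln (M.E s) - ln r ∣ ≤ 0#)
            (rate x l) (∣x-x∣≤y _ ≤-refl)
        ; step  = λ {_} {x} l → forth x l
        }

      M′≲M : IsSimulation ε 0# M′ M (flip (Left S T C))
      M′≲M = record
        { label = λ {x} l → ≐-sym (label x l)
        ; rate  = λ {x} {s} l → ≡.subst (λ r → ∣ ln r - ln (M.E s) ∣ ≤ 0#)
            (rate x l) (∣x-x∣≤y _ ≤-refl)
        ; step  = λ {x} l → back x l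
        }

theorem3 : (reals : Reals) →
    let open Reals reals
        open Theory reals
    in
    (AP : Set) (ε δ : ℝ) → 0# ≤ ε → 0# ≤ δ →
    (S T : FiniteSet) (M : CTMC AP S) (N : CTMC AP T) →
    M ∼[ ε , δ ] N →
    Σ FiniteSet λ S′ → Σ (CTMC AP S′) λ M′ → Σ (CTMC AP S′) λ N′ →
      SameGraph M′ N′ × M ∼[ ε , 0# ] M′ × M′ ∼[ 0# , δ ] N′ × N′ ∼ N
theorem3 reals AP ε δ 0≤ε 0≤δ S T M N (R , bisim , init-related) =
  U , M′ , N′ , sameGraph , M∼M′ , M′∼N′ , N′∼N
  where
  open Decomposition reals
  open Construction 0≤ε 0≤δ M N
    (λ s t → Theory.IsApproxBisimulation.R? bisim (inj₁ s) (inj₂ t))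
    (bisimulation⇒simulation bisim) init-related
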